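{- The equation \[ V=1+\frac{y}{x}-\frac{1}{x}V-V_x-\frac{1}{x}V_y+\frac{1}{x}\log V \] has one and only one solution $V$ in the ring $A$ (with $V\in U$, so that $\log V$ is defined).
   Context: Let $A$ be the ring of formal series $a=\sum_{n=0}^\infty \frac{q_n(y)}{x^n}$, where each $q_n$ is a polynomial with complex coefficients of degree at most $n$ (so $q_0$ is a constant), with the obvious addition and multiplication (equivalently $A\cong\mathbb{C}[[X,Y]]$ via $X\mapsto x^{ -1}$, $Y\mapsto y x^{ -1}$). For nonzero $a$ let $\deg(a)$ be the least $n$ with $q_n\neq0$, $\deg(0)=\infty$, and give $A$ the complete metric induced by $\|a\|=2^{ -\deg(a)}$. Formal derivatives: $a_x=-\sum_{n\ge1}\frac{n q_n(y)}{x^{n+1}}$, $a_y=\sum_{n\ge1}\frac{q_n'(y)}{x^n}$. Let $U\subset A$ be the set of elements with $q_0=1$; for $1+u\in U$ define $\log(1+u)=\sum_{k\ge1}(-1)^{k+1}\frac{u^k}{k}$ (convergent in $A$). -}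

module Defs where

open import Algebra.Bundles using (CommutativeRing)
import Algebra.Definitions.RawMonoid as RawMonoidOps
import Algebra.Properties.Monoid.Sum as MonoidSum
import Algebra.Properties.Ring as RingProperties
open import Data.Fin.Base using (Fin; toℕ)
import Data.Fin.Properties as Fin
open import Data.Integer.Base as ℤ using (-1ℤ)
open import Data.Nat.Base as ℕ using (ℕ; zero; suc; _∸_; _⊔_; z≤n; s≤s)
import Data.Nat.Properties as ℕ
open import Data.Product using (∃; _×_; _,_; proj₁; proj₂)
open import Data.Rational.Base as ℚ using (ℚ; 0ℚ; 1ℚ; ½; ∣_∣; 1/_)
import Data.Rational.Properties as ℚ
open import Data.Rational.Solver using (module +-*-Solver)
open import Data.Sum.Base using (inj₁; inj₂)
open import Level using (0ℓ)
open import Relation.Binary.PropositionalEquality as ≡ using (_≡_)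
open import Relation.Nullary.Decidable using (yes; no)

------------------------------------------------------------------------
-- Rational-valued families that become arbitrarily small along a family
-- of tails; used below both for single and for double sequences

private
  module Small {J : Set} (_⊒_ : J → ℕ → Set)
               (weaken : ∀ {j M N} → M ℕ.≤ N → j ⊒ N → j ⊒ M) where

    Small : (J → ℚ) → Set
    Small f = ∀ ε → 0ℚ ℚ.< ε → ∃ λ N → ∀ j → j ⊒ N → ∣ f j ∣ ℚ.< ε

    Bounded : (J → ℚ) → Set
    Bounded f = ∃ λ B → 0ℚ ℚ.< B × ∃ λ N → ∀ j → j ⊒ N → ∣ f j ∣ ℚ.≤ B

    small-≗ : ∀ f g → (∀ j → f j ≡ g j) → Small f → Small g
    small-≗ f g f≗g sf ε 0<ε with sf ε 0<ε
    ... | N , h = N , λ j j⊒N → ≡.subst (λ z → ∣ z ∣ ℚ.< ε) (f≗g j) (h j j⊒N)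

    small-0 : Small (λ _ → 0ℚ)
    small-0 ε 0<ε = 0 , λ _ _ → 0<ε

    small-neg : ∀ f → Small f → Small (λ j → ℚ.- f j)
    small-neg f sf ε 0<ε with sf ε 0<ε
    ... | N , h = N , λ j j⊒N →
      ≡.subst (ℚ._< ε) (≡.sym (ℚ.∣-p∣≡∣p∣ (f j))) (h j j⊒N)

    small-+ : ∀ f g → Small f → Small g → Small (λ j → f j ℚ.+ g j)
    small-+ f g sf sg ε 0<ε = M ⊔ N , bound
      where
      δ = ½ ℚ.* ε
      0<δ : 0ℚ ℚ.< δ
      0<δ = ≡.subst (ℚ._< δ) (ℚ.*-zeroʳ ½) (ℚ.*-monoʳ-<-pos ½ 0<ε)
      δ+δ≡ε : δ ℚ.+ δ ≡ ε
      δ+δ≡ε = ≡.trans (≡.sym (ℚ.*-distribʳ-+ ε ½ ½)) (ℚ.*-identityˡ ε)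
      M = proj₁ (sf δ 0<δ)
      N = proj₁ (sg δ 0<δ)
      bound : ∀ j → j ⊒ (M ⊔ N) → ∣ f j ℚ.+ g j ∣ ℚ.< ε
      bound j j⊒ = ≡.subst (∣ f j ℚ.+ g j ∣ ℚ.<_) δ+δ≡ε
        (ℚ.≤-<-trans (ℚ.∣p+q∣≤∣p∣+∣q∣ (f j) (g j))
          (ℚ.+-mono-< (proj₂ (sf δ 0<δ) j (weaken (ℕ.m≤m⊔n M N) j⊒))
                      (proj₂ (sg δ 0<δ) j (weaken (ℕ.m≤n⊔m M N) j⊒))))

    small-* : ∀ f g → Bounded f → Small g → Small (λ j → f j ℚ.* g j)
    small-* f g (B , 0<B , M , bf) sg ε 0<ε = M ⊔ N , bound
      where
      instance
        B-pos = ℚ.positive 0<B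
        B-nonNeg = ℚ.pos⇒nonNeg B
        B-nonZero = ℚ.pos⇒nonZero B
        1/B-pos = ℚ.1/pos⇒pos B
      δ = 1/ B ℚ.* ε
      0<δ : 0ℚ ℚ.< δ
      0<δ = ≡.subst (ℚ._< δ) (ℚ.*-zeroʳ (1/ B)) (ℚ.*-monoʳ-<-pos (1/ B) 0<ε)
      Bδ≡ε : B ℚ.* δ ≡ ε
      Bδ≡ε = ≡.trans (≡.sym (ℚ.*-assoc B (1/ B) ε))
        (≡.trans (≡.cong (ℚ._* ε) (ℚ.*-inverseʳ B)) (ℚ.*-identityˡ ε))
      N = proj₁ (sg δ 0<δ)
      bound : ∀ j → j ⊒ (M ⊔ N) → ∣ f j ℚ.* g j ∣ ℚ.< ε
      bound j j⊒ = begin-strict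
        ∣ f j ℚ.* g j ∣     ≡⟨ ℚ.∣p*q∣≡∣p∣*∣q∣ (f j) (g j) ⟩
        ∣ f j ∣ ℚ.* ∣ g j ∣ ≤⟨ ℚ.*-monoʳ-≤-nonNeg ∣ g j ∣ {{ℚ.∣-∣-nonNeg (g j)}} (bf j (weaken (ℕ.m≤m⊔n M N) j⊒)) ⟩
        B ℚ.* ∣ g j ∣       <⟨ ℚ.*-monoʳ-<-pos B (proj₂ (sg δ 0<δ) j (weaken (ℕ.m≤n⊔m M N) j⊒)) ⟩
        B ℚ.* δ             ≡⟨ Bδ≡ε ⟩
        ε                   ∎
        where open ℚ.≤-Reasoning

  module S₁ = Small {ℕ} (λ n N → N ℕ.≤ n) ℕ.≤-trans
  module S₂ = Small {ℕ × ℕ} (λ p N → N ℕ.≤ proj₁ p × N ℕ.≤ proj₂ p)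
                    (λ M≤N (p , q) → ℕ.≤-trans M≤N p , ℕ.≤-trans M≤N q)

------------------------------------------------------------------------
-- Real numbers: Cauchy sequences of rationals, with the setoid equality
-- "the difference tends to 0"

IsCauchy : (ℕ → ℚ) → Set
IsCauchy x = ∀ ε → 0ℚ ℚ.< ε →
  ∃ λ N → ∀ m n → N ℕ.≤ m → N ℕ.≤ n → ∣ x m ℚ.- x n ∣ ℚ.< ε

record ℝ : Set where
  no-eta-equality
  constructor mkℝ
  field
    seq    : ℕ → ℚ
    cauchy : IsCauchy seq

open ℝ

infix 4 _≃_

record _≃_ (x y : ℝ) : Set where
  constructor mk≃
  field
    null : ∀ ε → 0ℚ ℚ.< ε →
      ∃ λ N → ∀ n → N ℕ.≤ n → ∣ seq x n ℚ.- seq y n ∣ ℚ.< ε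

open _≃_

private
  Δ : (ℕ → ℚ) → ℕ × ℕ → ℚ
  Δ x (m , n) = x m ℚ.- x n

  toS₂ : ∀ x → IsCauchy x → S₂.Small (Δ x)
  toS₂ x c ε 0<ε with c ε 0<ε
  ... | N , h = N , λ (m , n) (N≤m , N≤n) → h m n N≤m N≤n

  fromS₂ : ∀ x → S₂.Small (Δ x) → IsCauchy x
  fromS₂ x c ε 0<ε with c ε 0<ε
  ... | N , h = N , λ m n N≤m N≤n → h (m , n) (N≤m , N≤n)

  eventuallyBounded : ∀ x → IsCauchy x → S₁.Bounded x
  eventuallyBounded x c = 1ℚ ℚ.+ ∣ x N ∣ , 0<B , N , bound
    where
    N = proj₁ (c 1ℚ (ℚ.positive⁻¹ 1ℚ))
    near = proj₂ (c 1ℚ (ℚ.positive⁻¹ 1ℚ))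
    0<B : 0ℚ ℚ.< 1ℚ ℚ.+ ∣ x N ∣
    0<B = ℚ.+-mono-<-≤ (ℚ.positive⁻¹ 1ℚ) (ℚ.0≤∣p∣ (x N))
    split : ∀ a b → a ≡ (a ℚ.- b) ℚ.+ b
    split = solve 2 (λ a b → a := (a :- b) :+ b) ≡.refl
      where open +-*-Solver
    bound : ∀ n → N ℕ.≤ n → ∣ x n ∣ ℚ.≤ 1ℚ ℚ.+ ∣ x N ∣
    bound n N≤n = begin
      ∣ x n ∣                       ≡⟨ ≡.cong ∣_∣ (split (x n) (x N)) ⟩
      ∣ (x n ℚ.- x N) ℚ.+ x N ∣     ≤⟨ ℚ.∣p+q∣≤∣p∣+∣q∣ (x n ℚ.- x N) (x N) ⟩
      ∣ x n ℚ.- x N ∣ ℚ.+ ∣ x N ∣   ≤⟨ ℚ.+-monoˡ-≤ ∣ x N ∣ (ℚ.<⇒≤ (near n N N≤n ℕ.≤-refl)) ⟩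
      1ℚ ℚ.+ ∣ x N ∣                ∎
      where open ℚ.≤-Reasoning

  bounded-fst : ∀ x → S₁.Bounded x → S₂.Bounded (λ p → x (proj₁ p))
  bounded-fst x (B , 0<B , N , h) = B , 0<B , N , λ (m , n) (N≤m , N≤n) → h m N≤m

  bounded-snd : ∀ x → S₁.Bounded x → S₂.Bounded (λ p → x (proj₂ p))
  bounded-snd x (B , 0<B , N , h) = B , 0<B , N , λ (m , n) (N≤m , N≤n) → h n N≤n

  diff-+ : ∀ a b c d → (a ℚ.- b) ℚ.+ (c ℚ.- d) ≡ (a ℚ.+ c) ℚ.- (b ℚ.+ d)
  diff-+ = solve 4 (λ a b c d → (a :- b) :+ (c :- d) := (a :+ c) :- (b :+ d)) ≡.refl
    where open +-*-Solver

  diff-* : ∀ a b c d → a ℚ.* (c ℚ.- d) ℚ.+ d ℚ.* (a ℚ.- b) ≡ a ℚ.* c ℚ.- b ℚ.* d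
  diff-* = solve 4 (λ a b c d → a :* (c :- d) :+ d :* (a :- b) := a :* c :- b :* d) ≡.refl
    where open +-*-Solver

  diff-neg : ∀ a b → ℚ.- (a ℚ.- b) ≡ (ℚ.- a) ℚ.- (ℚ.- b)
  diff-neg = solve 2 (λ a b → :- (a :- b) := (:- a) :- (:- b)) ≡.refl
    where open +-*-Solver

  diff-swap : ∀ a b → ℚ.- (a ℚ.- b) ≡ b ℚ.- a
  diff-swap = solve 2 (λ a b → :- (a :- b) := b :- a) ≡.refl
    where open +-*-Solver

  diff-trans : ∀ a b c → (a ℚ.- b) ℚ.+ (b ℚ.- c) ≡ a ℚ.- c
  diff-trans = solve 3 (λ a b c → (a :- b) :+ (b :- c) := a :- c) ≡.refl
    where open +-*-Solver

infixl 6 _+ʳ_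
infixl 7 _*ʳ_
infix  8 -ʳ_

_+ʳ_ : ℝ → ℝ → ℝ
seq    (x +ʳ y) n = seq x n ℚ.+ seq y n
cauchy (x +ʳ y) = fromS₂ s (S₂.small-≗ (λ p → Δ (seq x) p ℚ.+ Δ (seq y) p) (Δ s)
  (λ (m , n) → diff-+ (seq x m) (seq x n) (seq y m) (seq y n))
  (S₂.small-+ (Δ (seq x)) (Δ (seq y))
    (toS₂ (seq x) (cauchy x)) (toS₂ (seq y) (cauchy y))))
  where
  s : ℕ → ℚ
  s n = seq x n ℚ.+ seq y n

_*ʳ_ : ℝ → ℝ → ℝ
seq    (x *ʳ y) n = seq x n ℚ.* seq y n
cauchy (x *ʳ y) = fromS₂ s (S₂.small-≗ (λ p → f p ℚ.+ g p) (Δ s)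
  (λ (m , n) → diff-* (seq x m) (seq x n) (seq y m) (seq y n))
  (S₂.small-+ f g
    (S₂.small-* (λ p → seq x (proj₁ p)) (Δ (seq y))
      (bounded-fst (seq x) (eventuallyBounded (seq x) (cauchy x))) (toS₂ (seq y) (cauchy y)))
    (S₂.small-* (λ p → seq y (proj₂ p)) (Δ (seq x))
      (bounded-snd (seq y) (eventuallyBounded (seq y) (cauchy y))) (toS₂ (seq x) (cauchy x)))))
  where
  s : ℕ → ℚ
  s n = seq x n ℚ.* seq y n
  f g : ℕ × ℕ → ℚ
  f p = seq x (proj₁ p) ℚ.* Δ (seq y) p
  g p = seq y (proj₂ p) ℚ.* Δ (seq x) p

-ʳ_ : ℝ → ℝ
seq    (-ʳ x) n = ℚ.- seq x n
cauchy (-ʳ x) = fromS₂ s (S₂.small-≗ (λ p → ℚ.- Δ (seq x) p) (Δ s)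
  (λ (m , n) → diff-neg (seq x m) (seq x n))
  (S₂.small-neg (Δ (seq x)) (toS₂ (seq x) (cauchy x))))
  where
  s : ℕ → ℚ
  s n = ℚ.- seq x n

ℚ→ℝ : ℚ → ℝ
seq    (ℚ→ℝ r) _ = r
cauchy (ℚ→ℝ r) = fromS₂ (λ _ → r)
  (S₂.small-≗ (λ _ → 0ℚ) (Δ (λ _ → r)) (λ _ → ≡.sym (ℚ.+-inverseʳ r)) S₂.small-0)

private
  δ : ℝ → ℝ → ℕ → ℚ
  δ x y n = seq x n ℚ.- seq y n

  pointwise : ∀ {x y} → (∀ n → seq x n ≡ seq y n) → x ≃ y
  pointwise {x} {y} h = mk≃ (S₁.small-≗ (λ _ → 0ℚ) (δ x y)
    (λ n → ≡.sym (≡.trans (≡.cong (ℚ._- seq y n) (h n)) (ℚ.+-inverseʳ (seq y n))))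
    S₁.small-0)

  ≃-refl : ∀ {x} → x ≃ x
  ≃-refl = pointwise (λ _ → ≡.refl)

  ≃-sym : ∀ {x y} → x ≃ y → y ≃ x
  ≃-sym {x} {y} p = mk≃ (S₁.small-≗ (λ n → ℚ.- δ x y n) (δ y x)
    (λ n → diff-swap (seq x n) (seq y n))
    (S₁.small-neg (δ x y) (null p)))

  ≃-trans : ∀ {x y z} → x ≃ y → y ≃ z → x ≃ z
  ≃-trans {x} {y} {z} p r = mk≃ (S₁.small-≗ (λ n → δ x y n ℚ.+ δ y z n) (δ x z)
    (λ n → diff-trans (seq x n) (seq y n) (seq z n))
    (S₁.small-+ (δ x y) (δ y z) (null p) (null r)))

  +ʳ-cong : ∀ {x x′ y y′} → x ≃ x′ → y ≃ y′ → x +ʳ y ≃ x′ +ʳ y′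
  +ʳ-cong {x} {x′} {y} {y′} p r = mk≃ (S₁.small-≗
    (λ n → δ x x′ n ℚ.+ δ y y′ n) (δ (x +ʳ y) (x′ +ʳ y′))
    (λ n → diff-+ (seq x n) (seq x′ n) (seq y n) (seq y′ n))
    (S₁.small-+ (δ x x′) (δ y y′) (null p) (null r)))

  *ʳ-cong : ∀ {x x′ y y′} → x ≃ x′ → y ≃ y′ → x *ʳ y ≃ x′ *ʳ y′
  *ʳ-cong {x} {x′} {y} {y′} p r = mk≃ (S₁.small-≗
    (λ n → f n ℚ.+ g n) (δ (x *ʳ y) (x′ *ʳ y′))
    (λ n → diff-* (seq x n) (seq x′ n) (seq y n) (seq y′ n))
    (S₁.small-+ f g
      (S₁.small-* (seq x) (δ y y′) (eventuallyBounded (seq x) (cauchy x)) (null r))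
      (S₁.small-* (seq y′) (δ x x′) (eventuallyBounded (seq y′) (cauchy y′)) (null p))))
    where
    f g : ℕ → ℚ
    f n = seq x n ℚ.* δ y y′ n
    g n = seq y′ n ℚ.* δ x x′ n

  -ʳ-cong : ∀ {x y} → x ≃ y → -ʳ x ≃ -ʳ y
  -ʳ-cong {x} {y} p = mk≃ (S₁.small-≗ (λ n → ℚ.- δ x y n) (δ (-ʳ x) (-ʳ y))
    (λ n → diff-neg (seq x n) (seq y n)) (S₁.small-neg (δ x y) (null p)))

ℝ-commutativeRing : CommutativeRing 0ℓ 0ℓ
ℝ-commutativeRing = record
  { Carrier = ℝ
  ; _≈_ = _≃_
  ; _+_ = _+ʳ_
  ; _*_ = _*ʳ_
  ; -_ = -ʳ_
  ; 0# = ℚ→ℝ 0ℚ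
  ; 1# = ℚ→ℝ 1ℚ
  ; isCommutativeRing = record
    { isRing = record
      { +-isAbelianGroup = record
        { isGroup = record
          { isMonoid = record
            { isSemigroup = record
              { isMagma = record
                { isEquivalence = record
                  { refl = ≃-refl ; sym = ≃-sym ; trans = ≃-trans }
                ; ∙-cong = +ʳ-cong
                }
              ; assoc = λ x y z → pointwise (λ n → ℚ.+-assoc (seq x n) (seq y n) (seq z n))
              }
            ; identity = (λ x → pointwise (λ n → ℚ.+-identityˡ (seq x n)))
                       , (λ x → pointwise (λ n → ℚ.+-identityʳ (seq x n)))
            }
          ; inverse = (λ x → pointwise (λ n → ℚ.+-inverseˡ (seq x n)))
                    , (λ x → pointwise (λ n → ℚ.+-inverseʳ (seq x n)))
          ; ⁻¹-cong = -ʳ-cong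
          }
        ; comm = λ x y → pointwise (λ n → ℚ.+-comm (seq x n) (seq y n))
        }
      ; *-cong = *ʳ-cong
      ; *-assoc = λ x y z → pointwise (λ n → ℚ.*-assoc (seq x n) (seq y n) (seq z n))
      ; *-identity = (λ x → pointwise (λ n → ℚ.*-identityˡ (seq x n)))
                   , (λ x → pointwise (λ n → ℚ.*-identityʳ (seq x n)))
      ; distrib = (λ x y z → pointwise (λ n → ℚ.*-distribˡ-+ (seq x n) (seq y n) (seq z n)))
                , (λ x y z → pointwise (λ n → ℚ.*-distribʳ-+ (seq x n) (seq y n) (seq z n)))
      }
    ; *-comm = λ x y → pointwise (λ n → ℚ.*-comm (seq x n) (seq y n))
    }
  }

record ℂ : Set where
  no-eta-equality
  constructor _+i_
  field
    re im : ℝ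

open ℂ

record _≈ᶜ_ (z w : ℂ) : Set where
  constructor _,ᶜ_
  field
    re-≃ : re z ≃ re w
    im-≃ : im z ≃ im w

infixl 6 _+ᶜ_
infixl 7 _*ᶜ_
infix  8 -ᶜ_

_+ᶜ_ _*ᶜ_ : ℂ → ℂ → ℂ
re (z +ᶜ w) = re z +ʳ re w
im (z +ᶜ w) = im z +ʳ im w
re (z *ᶜ w) = re z *ʳ re w +ʳ -ʳ (im z *ʳ im w)
im (z *ᶜ w) = re z *ʳ im w +ʳ im z *ʳ re w

-ᶜ_ : ℂ → ℂ
re (-ᶜ z) = -ʳ re z
im (-ᶜ z) = -ʳ im z

ℚ→ℂ : ℚ → ℂ
re (ℚ→ℂ r) = ℚ→ℝ r
im (ℚ→ℂ r) = ℚ→ℝ 0ℚ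

private
  module ℝ-Ring = CommutativeRing ℝ-commutativeRing

  re-assoc : ∀ a b c d e f →
    (a ℚ.* c ℚ.- b ℚ.* d) ℚ.* e ℚ.- (a ℚ.* d ℚ.+ b ℚ.* c) ℚ.* f
      ≡ a ℚ.* (c ℚ.* e ℚ.- d ℚ.* f) ℚ.- b ℚ.* (c ℚ.* f ℚ.+ d ℚ.* e)
  re-assoc = solve 6 (λ a b c d e f →
    (a :* c :- b :* d) :* e :- (a :* d :+ b :* c) :* f
      := a :* (c :* e :- d :* f) :- b :* (c :* f :+ d :* e)) ≡.refl
    where open +-*-Solver

  im-assoc : ∀ a b c d e f →
    (a ℚ.* c ℚ.- b ℚ.* d) ℚ.* f ℚ.+ (a ℚ.* d ℚ.+ b ℚ.* c) ℚ.* e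
      ≡ a ℚ.* (c ℚ.* f ℚ.+ d ℚ.* e) ℚ.+ b ℚ.* (c ℚ.* e ℚ.- d ℚ.* f)
  im-assoc = solve 6 (λ a b c d e f →
    (a :* c :- b :* d) :* f :+ (a :* d :+ b :* c) :* e
      := a :* (c :* f :+ d :* e) :+ b :* (c :* e :- d :* f)) ≡.refl
    where open +-*-Solver

  re-distribˡ : ∀ a b c d e f →
    a ℚ.* (c ℚ.+ e) ℚ.- b ℚ.* (d ℚ.+ f)
      ≡ (a ℚ.* c ℚ.- b ℚ.* d) ℚ.+ (a ℚ.* e ℚ.- b ℚ.* f)
  re-distribˡ = solve 6 (λ a b c d e f →
    a :* (c :+ e) :- b :* (d :+ f)
      := (a :* c :- b :* d) :+ (a :* e :- b :* f)) ≡.refl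
    where open +-*-Solver

  im-distribˡ : ∀ a b c d e f →
    a ℚ.* (d ℚ.+ f) ℚ.+ b ℚ.* (c ℚ.+ e)
      ≡ (a ℚ.* d ℚ.+ b ℚ.* c) ℚ.+ (a ℚ.* f ℚ.+ b ℚ.* e)
  im-distribˡ = solve 6 (λ a b c d e f →
    a :* (d :+ f) :+ b :* (c :+ e)
      := (a :* d :+ b :* c) :+ (a :* f :+ b :* e)) ≡.refl
    where open +-*-Solver

  re-comm : ∀ a b c d → a ℚ.* c ℚ.- b ℚ.* d ≡ c ℚ.* a ℚ.- d ℚ.* b
  re-comm = solve 4 (λ a b c d → a :* c :- b :* d := c :* a :- d :* b) ≡.refl
    where open +-*-Solver

  im-comm : ∀ a b c d → a ℚ.* d ℚ.+ b ℚ.* c ≡ c ℚ.* b ℚ.+ d ℚ.* a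
  im-comm = solve 4 (λ a b c d → a :* d :+ b :* c := c :* b :+ d :* a) ≡.refl
    where open +-*-Solver

  re-identityˡ : ∀ a b → 1ℚ ℚ.* a ℚ.- 0ℚ ℚ.* b ≡ a
  re-identityˡ = solve 2 (λ a b → con 1ℚ :* a :- con 0ℚ :* b := a) ≡.refl
    where open +-*-Solver

  im-identityˡ : ∀ a b → 1ℚ ℚ.* b ℚ.+ 0ℚ ℚ.* a ≡ b
  im-identityˡ = solve 2 (λ a b → con 1ℚ :* b :+ con 0ℚ :* a := b) ≡.refl
    where open +-*-Solver

  ≈ᶜ-trans : ∀ {z w v} → z ≈ᶜ w → w ≈ᶜ v → z ≈ᶜ v
  ≈ᶜ-trans (p ,ᶜ r) (p′ ,ᶜ r′) = ≃-trans p p′ ,ᶜ ≃-trans r r′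

  +ᶜ-cong : ∀ {z z′ w w′} → z ≈ᶜ z′ → w ≈ᶜ w′ → (z +ᶜ w) ≈ᶜ (z′ +ᶜ w′)
  +ᶜ-cong (p ,ᶜ r) (p′ ,ᶜ r′) = +ʳ-cong p p′ ,ᶜ +ʳ-cong r r′

  *ᶜ-comm : ∀ z w → (z *ᶜ w) ≈ᶜ (w *ᶜ z)
  *ᶜ-comm z w =
    pointwise (λ n → re-comm (seq (re z) n) (seq (im z) n) (seq (re w) n) (seq (im w) n)) ,ᶜ
    pointwise (λ n → im-comm (seq (re z) n) (seq (im z) n) (seq (re w) n) (seq (im w) n))

  *ᶜ-assoc : ∀ z w v → ((z *ᶜ w) *ᶜ v) ≈ᶜ (z *ᶜ (w *ᶜ v))
  *ᶜ-assoc z w v =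
    pointwise (λ n → re-assoc (seq (re z) n) (seq (im z) n) (seq (re w) n) (seq (im w) n) (seq (re v) n) (seq (im v) n)) ,ᶜ
    pointwise (λ n → im-assoc (seq (re z) n) (seq (im z) n) (seq (re w) n) (seq (im w) n) (seq (re v) n) (seq (im v) n))

  *ᶜ-identityˡ : ∀ z → (ℚ→ℂ 1ℚ *ᶜ z) ≈ᶜ z
  *ᶜ-identityˡ z =
    pointwise (λ n → re-identityˡ (seq (re z) n) (seq (im z) n)) ,ᶜ
    pointwise (λ n → im-identityˡ (seq (re z) n) (seq (im z) n))

  *ᶜ-distribˡ : ∀ z w v → (z *ᶜ (w +ᶜ v)) ≈ᶜ (z *ᶜ w +ᶜ z *ᶜ v)
  *ᶜ-distribˡ z w v =
    pointwise (λ n → re-distribˡ (seq (re z) n) (seq (im z) n) (seq (re w) n) (seq (im w) n) (seq (re v) n) (seq (im v) n)) ,ᶜ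
    pointwise (λ n → im-distribˡ (seq (re z) n) (seq (im z) n) (seq (re w) n) (seq (im w) n) (seq (re v) n) (seq (im v) n))

  *ᶜ-distribʳ : ∀ z w v → ((w +ᶜ v) *ᶜ z) ≈ᶜ (w *ᶜ z +ᶜ v *ᶜ z)
  *ᶜ-distribʳ z w v = ≈ᶜ-trans (*ᶜ-comm (w +ᶜ v) z)
    (≈ᶜ-trans (*ᶜ-distribˡ z w v) (+ᶜ-cong (*ᶜ-comm z w) (*ᶜ-comm z v)))

ℂ-commutativeRing : CommutativeRing 0ℓ 0ℓ
ℂ-commutativeRing = record
  { Carrier = ℂ
  ; _≈_ = _≈ᶜ_
  ; _+_ = _+ᶜ_
  ; _*_ = _*ᶜ_
  ; -_ = -ᶜ_
  ; 0# = ℚ→ℂ 0ℚ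
  ; 1# = ℚ→ℂ 1ℚ
  ; isCommutativeRing = record
    { isRing = record
      { +-isAbelianGroup = record
        { isGroup = record
          { isMonoid = record
            { isSemigroup = record
              { isMagma = record
                { isEquivalence = record
                  { refl = ≃-refl ,ᶜ ≃-refl
                  ; sym = λ (p ,ᶜ r) → ≃-sym p ,ᶜ ≃-sym r
                  ; trans = ≈ᶜ-trans
                  }
                ; ∙-cong = +ᶜ-cong
                }
              ; assoc = λ z w v →
                  ℝ-Ring.+-assoc (re z) (re w) (re v) ,ᶜ ℝ-Ring.+-assoc (im z) (im w) (im v)
              }
            ; identity =
                (λ z → ℝ-Ring.+-identityˡ (re z) ,ᶜ ℝ-Ring.+-identityˡ (im z)) ,
                (λ z → ℝ-Ring.+-identityʳ (re z) ,ᶜ ℝ-Ring.+-identityʳ (im z))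
            }
          ; inverse =
              (λ z → ℝ-Ring.-‿inverseˡ (re z) ,ᶜ ℝ-Ring.-‿inverseˡ (im z)) ,
              (λ z → ℝ-Ring.-‿inverseʳ (re z) ,ᶜ ℝ-Ring.-‿inverseʳ (im z))
          ; ⁻¹-cong = λ (p ,ᶜ r) → -ʳ-cong p ,ᶜ -ʳ-cong r
          }
        ; comm = λ z w → ℝ-Ring.+-comm (re z) (re w) ,ᶜ ℝ-Ring.+-comm (im z) (im w)
        }
      ; *-cong = λ (p ,ᶜ r) (p′ ,ᶜ r′) →
          +ʳ-cong (*ʳ-cong p p′) (-ʳ-cong (*ʳ-cong r r′)) ,ᶜ
          +ʳ-cong (*ʳ-cong p r′) (*ʳ-cong r p′)
      ; *-assoc = *ᶜ-assoc
      ; *-identity = *ᶜ-identityˡ ,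
          (λ z → ≈ᶜ-trans (*ᶜ-comm z (ℚ→ℂ 1ℚ)) (*ᶜ-identityˡ z))
      ; distrib = *ᶜ-distribˡ , *ᶜ-distribʳ
      }
    ; *-comm = *ᶜ-comm
    }
  }

------------------------------------------------------------------------
-- The ring A of formal series Σ qₙ(y)/xⁿ with deg qₙ ≤ n. The
-- coefficients are kept abstract here and are instantiated with ℂ at the
-- end; ι supplies the rational scalars appearing in log.

module FormalSeries (K : CommutativeRing 0ℓ 0ℓ) (ι : ℚ → CommutativeRing.Carrier K) where

  private
    module K = CommutativeRing K
    module KP = RingProperties K.ring
    module Sum = MonoidSum K.+-monoid
    open K using (Carrier; _≈_; 0#; 1#)
    open Sum using (sum; sum⁺-syntax)
    open RawMonoidOps K.+-rawMonoid using () renaming (_×_ to _×ₖ_)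

  -- q a n i is the coefficient of yⁱ/xⁿ.
  record A : Set where
    no-eta-equality
    constructor mkA
    field
      q     : ℕ → ℕ → Carrier
      deg-q : ∀ n i → n ℕ.< i → q n i ≈ 0#

  open A public

  infix 4 _≈ᴬ_

  record _≈ᴬ_ (a b : A) : Set where
    constructor mk≈
    field
      coeff-≈ : ∀ n i → q a n i ≈ q b n i

  open _≈ᴬ_ public

  -0≈0 : ∀ {x} → x ≈ 0# → K.- x ≈ 0#
  -0≈0 p = K.trans (K.-‿cong p) KP.-0#≈0#

  0+0≈0 : ∀ {x y} → x ≈ 0# → y ≈ 0# → x K.+ y ≈ 0#
  0+0≈0 p r = K.trans (K.+-cong p r) (K.+-identityˡ 0#)

  0*≈0 : ∀ {x} y → x ≈ 0# → x K.* y ≈ 0#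
  0*≈0 y p = K.trans (K.*-congʳ p) (K.zeroˡ y)

  *0≈0 : ∀ x {y} → y ≈ 0# → x K.* y ≈ 0#
  *0≈0 x p = K.trans (K.*-congˡ p) (K.zeroʳ x)

  ×0≈0 : ∀ n {x} → x ≈ 0# → n ×ₖ x ≈ 0#
  ×0≈0 zero    p = K.refl
  ×0≈0 (suc n) p = 0+0≈0 p (×0≈0 n p)

  sum≈0 : ∀ {n} (f : Fin n → Carrier) → (∀ k → f k ≈ 0#) → sum f ≈ 0#
  sum≈0 {n} f h = K.trans (Sum.sum-cong-≋ h) (Sum.sum-replicate-zero n)

  infixl 6 _+_ _-_
  infixl 7 _*_ _·_
  infixr 8 _^_
  infix  8 -_

  0ᴬ : A
  q     0ᴬ _ _ = 0#
  deg-q 0ᴬ _ _ _ = K.refl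

  1ᴬ : A
  1ᴬ = mkA c vanish
    where
    c : ℕ → ℕ → Carrier
    c zero    zero    = 1#
    c zero    (suc _) = 0#
    c (suc _) _       = 0#
    vanish : ∀ n i → n ℕ.< i → c n i ≈ 0#
    vanish zero    (suc _) _ = K.refl
    vanish (suc _) _       _ = K.refl

  1/x : A
  1/x = mkA c vanish
    where
    c : ℕ → ℕ → Carrier
    c zero          _       = 0#
    c (suc zero)    zero    = 1#
    c (suc zero)    (suc _) = 0#
    c (suc (suc _)) _       = 0#
    vanish : ∀ n i → n ℕ.< i → c n i ≈ 0#
    vanish zero          _       _ = K.refl
    vanish (suc zero)    (suc _) _ = K.refl
    vanish (suc (suc _)) _       _ = K.refl

  y/x : A
  y/x = mkA c vanish
    where
    c : ℕ → ℕ → Carrier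
    c zero          _             = 0#
    c (suc zero)    zero          = 0#
    c (suc zero)    (suc zero)    = 1#
    c (suc zero)    (suc (suc _)) = 0#
    c (suc (suc _)) _             = 0#
    vanish : ∀ n i → n ℕ.< i → c n i ≈ 0#
    vanish zero          _             _ = K.refl
    vanish (suc zero)    (suc zero)    (s≤s ())
    vanish (suc zero)    (suc (suc _)) _ = K.refl
    vanish (suc (suc _)) _             _ = K.refl

  _+_ : A → A → A
  q     (a + b) n i = q a n i K.+ q b n i
  deg-q (a + b) n i n<i = 0+0≈0 (deg-q a n i n<i) (deg-q b n i n<i)

  -_ : A → A
  q     (- a) n i = K.- q a n i
  deg-q (- a) n i n<i = -0≈0 (deg-q a n i n<i)

  _-_ : A → A → A
  a - b = a + (- b)

  _·_ : Carrier → A → A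
  q     (c · a) n i = c K.* q a n i
  deg-q (c · a) n i n<i = *0≈0 c (deg-q a n i n<i)

  _*_ : A → A → A
  q     (a * b) n i = ∑[ k ≤ n ] ∑[ j ≤ i ]
    (q a (toℕ k) (toℕ j) K.* q b (n ∸ toℕ k) (i ∸ toℕ j))
  deg-q (a * b) n i n<i = sum≈0 {suc n} _ λ k → sum≈0 {suc i} _ λ j →
    term (toℕ k) (toℕ j) (ℕ.≤-pred (Fin.toℕ<n k))
    where
    term : ∀ k j → k ℕ.≤ n → q a k j K.* q b (n ∸ k) (i ∸ j) ≈ 0#
    term k j k≤n with k ℕ.<? j
    ... | yes k<j = 0*≈0 _ (deg-q a k j k<j)
    ... | no  k≮j = *0≈0 _ (deg-q b (n ∸ k) (i ∸ j)
      (ℕ.<-≤-trans (ℕ.∸-monoˡ-< n<i k≤n) (ℕ.∸-monoʳ-≤ i (ℕ.≮⇒≥ k≮j))))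

  _^_ : A → ℕ → A
  a ^ zero  = 1ᴬ
  a ^ suc k = a * a ^ k

  ∂x : A → A
  q     (∂x a) zero    i = 0#
  q     (∂x a) (suc n) i = K.- (n ×ₖ q a n i)
  deg-q (∂x a) zero    i _ = K.refl
  deg-q (∂x a) (suc n) i n+1<i =
    -0≈0 (×0≈0 n (deg-q a n i (ℕ.<-trans (ℕ.n<1+n n) n+1<i)))

  ∂y : A → A
  q     (∂y a) n i = suc i ×ₖ q a n (suc i)
  deg-q (∂y a) n i n<i = ×0≈0 (suc i) (deg-q a n (suc i) (ℕ.m<n⇒m<1+n n<i))

  -- N ≤deg a says deg a ≥ N, that is ‖a‖ ≤ 2⁻ᴺ. Stated as a relation since
  -- equality with 0 in ℂ is not decidable.
  infix 4 _≤deg_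

  _≤deg_ : ℕ → A → Set
  N ≤deg a = ∀ n → n ℕ.< N → ∀ i → q a n i ≈ 0#

  IsCauchySeq : (ℕ → A) → Set
  IsCauchySeq s = ∀ N → ∃ λ M → ∀ m n → M ℕ.≤ m → M ℕ.≤ n → N ≤deg (s m - s n)

  _ConvergesTo_ : (ℕ → A) → A → Set
  s ConvergesTo a = ∀ N → ∃ λ M → ∀ m → M ℕ.≤ m → N ≤deg (s m - a)

  diff≈0 : ∀ {x y} → x ≈ y → x K.- y ≈ 0#
  diff≈0 {x} {y} p = K.trans (K.+-congʳ p) (K.-‿inverseʳ y)

  lim : (s : ℕ → A) → IsCauchySeq s → A
  q     (lim s c) n = q (s (proj₁ (c (suc n)))) n
  deg-q (lim s c) n = deg-q (s (proj₁ (c (suc n)))) n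

  lim-converges : ∀ s c → s ConvergesTo lim s c
  lim-converges s c N = bound N , λ m bound≤m n n<N i →
    proj₂ (c (suc n)) m (proj₁ (c (suc n)))
      (ℕ.≤-trans (M≤bound N n n<N) bound≤m) ℕ.≤-refl n (ℕ.n<1+n n) i
    where
    bound : ℕ → ℕ
    bound zero    = zero
    bound (suc k) = bound k ⊔ proj₁ (c (suc k))
    M≤bound : ∀ k n → n ℕ.< k → proj₁ (c (suc n)) ℕ.≤ bound k
    M≤bound (suc k) n (s≤s n≤k) with ℕ.m≤n⇒m<n∨m≡n n≤k
    ... | inj₁ n<k = ℕ.≤-trans (M≤bound k n n<k) (ℕ.m≤m⊔n (bound k) _)
    ... | inj₂ ≡.refl = ℕ.m≤n⊔m (bound k) _

  record U (V : A) : Set where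
    constructor mkU
    field
      q₀≈1 : q V 0 0 ≈ 1#

  open U public

  logCoeff : (k : ℕ) .{{_ : ℕ.NonZero k}} → ℚ
  logCoeff k = (-1ℤ ℤ.^ (k ℕ.+ 1)) ℚ./ k

  logPartial : A → ℕ → A
  logPartial u zero    = 0ᴬ
  logPartial u (suc k) = logPartial u k + ι (logCoeff (suc k)) · u ^ suc k

  u₀≈0 : ∀ {V} → U V → 1 ≤deg (V - 1ᴬ)
  u₀≈0     V∈U zero    _        zero    = diff≈0 (q₀≈1 V∈U)
  u₀≈0 {V} V∈U zero    _        (suc i) = diff≈0 (deg-q V 0 (suc i) (s≤s z≤n))
  u₀≈0     V∈U (suc n) (s≤s ()) i

  deg-^ : ∀ u → 1 ≤deg u → ∀ k → k ≤deg (u ^ k)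
  deg-^ u du (suc k) n (s≤s n≤k) i = sum≈0 {suc n} _ λ l → sum≈0 {suc i} _ λ j →
    term (toℕ l) (toℕ j) (ℕ.≤-pred (Fin.toℕ<n l))
    where
    term : ∀ l j → l ℕ.≤ n → q u l j K.* q (u ^ k) (n ∸ l) (i ∸ j) ≈ 0#
    term zero    j _   = 0*≈0 _ (du 0 (s≤s z≤n) j)
    term (suc l) j l<n = *0≈0 _ (deg-^ u du k (n ∸ suc l)
      (ℕ.<-≤-trans (ℕ.∸-monoʳ-< (s≤s z≤n) l<n) n≤k) (i ∸ j))

  logPartial-cauchy : ∀ u → 1 ≤deg u → IsCauchySeq (logPartial u)
  logPartial-cauchy u du N = N , λ m n N≤m N≤n l l<N i →
    diff≈0 (K.trans (stable m N≤m l l<N i) (K.sym (stable n N≤n l l<N i)))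
    where
    stable : ∀ m → N ℕ.≤ m → ∀ n → n ℕ.< N → ∀ i →
      q (logPartial u m) n i ≈ q (logPartial u N) n i
    stable m N≤m n n<N i with ℕ.m≤n⇒m<n∨m≡n N≤m
    stable m N≤m n n<N i | inj₂ ≡.refl = K.refl
    stable (suc m) N≤m n n<N i | inj₁ (s≤s N≤m′) = K.trans
      (K.+-cong (stable m N≤m′ n n<N i)
        (*0≈0 _ (deg-^ u du (suc m) n (ℕ.<-≤-trans n<N N≤m) i)))
      (K.+-identityʳ _)

  log : (V : A) → U V → A
  log V V∈U = lim (logPartial (V - 1ᴬ)) (logPartial-cauchy (V - 1ᴬ) (u₀≈0 V∈U))

module Aℂ = FormalSeries ℂ-commutativeRing ℚ→ℂ

{-# OPTIONS --safe #-}

-- The right-hand side Φ(V) of the equation maps U into U and is contracting: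
-- multiplication by 1/x and ∂x raise the degree by one, while ∂y and log do
-- not lower it, so if V and W agree in all degrees below N, then Φ(V) and Φ(W)
-- agree in all degrees below N + 1. Banach's fixed point argument applies.

module Submission where

open import Algebra.Bundles using (CommutativeRing)
import Algebra.Properties.Monoid.Mult as MonoidMult
import Algebra.Properties.Monoid.Sum as MonoidSum
open import Data.Fin.Base using (toℕ)
import Data.Fin.Properties as Fin
open import Data.Nat.Base as ℕ using (ℕ; zero; suc; _∸_; z≤n; s≤s)
import Data.Nat.Properties as ℕ
open import Data.Product using (∃!; Σ; Σ-syntax; _,_; proj₁; proj₂)
open import Data.Rational.Base using (ℚ)
open import Level using (0ℓ)

open import Defs

module FixedPoint (K : CommutativeRing 0ℓ 0ℓ) (ι : ℚ → CommutativeRing.Carrier K) where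

  private
    module K = CommutativeRing K
    module Mult = MonoidMult K.+-monoid
    module Sum = MonoidSum K.+-monoid
    open K using (_≈_; 0#)

  open FormalSeries K ι

  -- a ≈[ N ] b says ‖a - b‖ ≤ 2⁻ᴺ.
  infix 4 _≈[_]_

  record _≈[_]_ (a : A) (N : ℕ) (b : A) : Set where
    constructor mk≈[]
    field
      coeff-≈[] : ∀ n → n ℕ.< N → ∀ i → q a n i ≈ q b n i

  open _≈[_]_

  ≈[0] : ∀ {a b} → a ≈[ 0 ] b
  ≈[0] = mk≈[] λ _ ()

  ≈[]-refl : ∀ {N a} → a ≈[ N ] a
  ≈[]-refl = mk≈[] λ _ _ _ → K.refl

  ≈[]-sym : ∀ {N a b} → a ≈[ N ] b → b ≈[ N ] a
  ≈[]-sym p = mk≈[] λ n n<N i → K.sym (coeff-≈[] p n n<N i)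

  ≈[]-trans : ∀ {N a b c} → a ≈[ N ] b → b ≈[ N ] c → a ≈[ N ] c
  ≈[]-trans p r = mk≈[] λ n n<N i → K.trans (coeff-≈[] p n n<N i) (coeff-≈[] r n n<N i)

  ≈[]-weaken : ∀ {M N a b} → M ℕ.≤ N → a ≈[ N ] b → a ≈[ M ] b
  ≈[]-weaken M≤N p = mk≈[] λ n n<M → coeff-≈[] p n (ℕ.<-≤-trans n<M M≤N)

  ≈ᴬ⇒≈[] : ∀ {N a b} → a ≈ᴬ b → a ≈[ N ] b
  ≈ᴬ⇒≈[] p = mk≈[] λ n _ → coeff-≈ p n

  ≈[]⇒≈ᴬ : ∀ {a b} → (∀ N → a ≈[ N ] b) → a ≈ᴬ b
  ≈[]⇒≈ᴬ p = mk≈ λ n → coeff-≈[] (p (suc n)) n (ℕ.n<1+n n)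

  +-cong-≈[] : ∀ {N a a′ b b′} → a ≈[ N ] a′ → b ≈[ N ] b′ → a + b ≈[ N ] a′ + b′
  +-cong-≈[] p r = mk≈[] λ n n<N i → K.+-cong (coeff-≈[] p n n<N i) (coeff-≈[] r n n<N i)

  -‿cong-≈[] : ∀ {N a b} → a ≈[ N ] b → - a ≈[ N ] - b
  -‿cong-≈[] p = mk≈[] λ n n<N i → K.-‿cong (coeff-≈[] p n n<N i)

  ·-cong-≈[] : ∀ {N} c {a b} → a ≈[ N ] b → c · a ≈[ N ] c · b
  ·-cong-≈[] c p = mk≈[] λ n n<N i → K.*-congˡ (coeff-≈[] p n n<N i)

  *-cong-≈[] : ∀ {N a a′ b b′} → a ≈[ N ] a′ → b ≈[ N ] b′ → a * b ≈[ N ] a′ * b′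
  *-cong-≈[] p r = mk≈[] λ n n<N i →
    Sum.sum-cong-≋ {suc n} λ k → Sum.sum-cong-≋ {suc i} λ j → K.*-cong
      (coeff-≈[] p (toℕ k) (ℕ.≤-<-trans (ℕ.≤-pred (Fin.toℕ<n k)) n<N) (toℕ j))
      (coeff-≈[] r (n ∸ toℕ k) (ℕ.≤-<-trans (ℕ.m∸n≤m n (toℕ k)) n<N) (i ∸ toℕ j))

  -- In the Cauchy product the terms with `k = 0` vanish because `c` has no part of degree 0; the
  -- other terms read `a` and `b` only in degrees strictly below `n`, hence below `N`.
  *-contractingʳ : ∀ {N} c {a b} → 1 ≤deg c → a ≈[ N ] b → c * a ≈[ suc N ] c * b
  *-contractingʳ {N} c {a} {b} 1≤c p = mk≈[] λ n n<1+N i →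
    Sum.sum-cong-≋ {suc n} λ k → Sum.sum-cong-≋ {suc i} λ j →
      term n (ℕ.≤-pred n<1+N) (toℕ k) (ℕ.≤-pred (Fin.toℕ<n k)) (toℕ j) (i ∸ toℕ j)
    where
    term : ∀ n → n ℕ.≤ N → ∀ k → k ℕ.≤ n → ∀ j l →
      q c k j K.* q a (n ∸ k) l ≈ q c k j K.* q b (n ∸ k) l
    term n n≤N zero    _   j l = K.trans (0*≈0 _ (1≤c 0 (s≤s z≤n) j))
      (K.sym (0*≈0 _ (1≤c 0 (s≤s z≤n) j)))
    term n n≤N (suc k) k<n j l = K.*-congˡ (coeff-≈[] p (n ∸ suc k)
      (ℕ.<-≤-trans (ℕ.∸-monoʳ-< (s≤s z≤n) k<n) n≤N) l)

  ^-cong-≈[] : ∀ {N a b} k → a ≈[ N ] b → a ^ k ≈[ N ] b ^ k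
  ^-cong-≈[] zero    p = ≈[]-refl
  ^-cong-≈[] (suc k) p = *-cong-≈[] p (^-cong-≈[] k p)

  -- Differentiating 1/xⁿ yields a multiple of 1/xⁿ⁺¹, so degree `suc n` of `∂x a` depends only on
  -- degree `n` of `a`.
  ∂x-contracting : ∀ {N a b} → a ≈[ N ] b → ∂x a ≈[ suc N ] ∂x b
  ∂x-contracting p = mk≈[] λ where
    zero    _         i → K.refl
    (suc n) (s≤s n<N) i → K.-‿cong (Mult.×-congʳ n (coeff-≈[] p n n<N i))

  ∂y-cong-≈[] : ∀ {N a b} → a ≈[ N ] b → ∂y a ≈[ N ] ∂y b
  ∂y-cong-≈[] p = mk≈[] λ n n<N i → Mult.×-congʳ (suc i) (coeff-≈[] p n n<N (suc i))

  logPartial-cong-≈[] : ∀ {N u v} k → u ≈[ N ] v → logPartial u k ≈[ N ] logPartial v k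
  logPartial-cong-≈[] zero    p = ≈[]-refl
  logPartial-cong-≈[] (suc k) p =
    +-cong-≈[] (logPartial-cong-≈[] k p) (·-cong-≈[] _ (^-cong-≈[] (suc k) p))

  log-cong-≈[] : ∀ {N V W} (V∈U : U V) (W∈U : U W) → V ≈[ N ] W → log V V∈U ≈[ N ] log W W∈U
  -- By the modulus chosen in `logPartial-cauchy`, degree `n` of the limit is read off the partial
  -- sum of index `suc n`, for `V` and `W` alike.
  log-cong-≈[] _ _ p = mk≈[] λ n →
    coeff-≈[] (logPartial-cong-≈[] (suc n) (+-cong-≈[] p ≈[]-refl)) n

  1≤deg[1/x] : 1 ≤deg 1/x
  1≤deg[1/x] zero    _        i = K.refl
  1≤deg[1/x] (suc _) (s≤s ())

  Φ : (V : A) → U V → A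
  Φ V V∈U = 1ᴬ + y/x - 1/x * V - ∂x V - 1/x * ∂y V + 1/x * log V V∈U

  Φ-contracting : ∀ {N V W} (V∈U : U V) (W∈U : U W) → V ≈[ N ] W → Φ V V∈U ≈[ suc N ] Φ W W∈U
  Φ-contracting V∈U W∈U p =
    +-cong-≈[]
      (+-cong-≈[]
        (+-cong-≈[]
          (+-cong-≈[] ≈[]-refl (-‿cong-≈[] (1/x*-contracting p)))
          (-‿cong-≈[] (∂x-contracting p)))
        (-‿cong-≈[] (1/x*-contracting (∂y-cong-≈[] p))))
      (1/x*-contracting (log-cong-≈[] V∈U W∈U p))
    where
    1/x*-contracting : ∀ {N a b} → a ≈[ N ] b → 1/x * a ≈[ suc N ] 1/x * b
    1/x*-contracting = *-contractingʳ 1/x 1≤deg[1/x]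

  -- Every summand of `Φ` except `1ᴬ` has constant coefficient 0.
  Φ∈U : ∀ V (V∈U : U V) → U (Φ V V∈U)
  Φ∈U V V∈U = mkU
    (drop (drop (drop (drop (drop K.refl K.refl) (-0≈0 (1/x*-q₀ V))) (-0≈0 K.refl))
      (-0≈0 (1/x*-q₀ (∂y V)))) (1/x*-q₀ (log V V∈U)))
    where
    drop : ∀ {x y z} → x ≈ z → y ≈ 0# → x K.+ y ≈ z
    drop p r = K.trans (K.+-cong p r) (K.+-identityʳ _)
    1/x*-q₀ : ∀ a → q (1/x * a) 0 0 ≈ 0#
    -- The double sum unfolds to a single product with left factor `0#`, followed by two trailing
    -- zeros.
    1/x*-q₀ a = drop (drop (K.zeroˡ (q a 0 0)) K.refl) K.refl

  -- Membership in `U` is carried along because `log`, and hence `Φ`, takes it as an argument.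
  iterate : ℕ → Σ A U
  iterate zero    = 1ᴬ , mkU K.refl
  iterate (suc k) = let V , V∈U = iterate k in Φ V V∈U , Φ∈U V V∈U

  iterate-step : ∀ k → proj₁ (iterate k) ≈[ k ] proj₁ (iterate (suc k))
  iterate-step zero    = ≈[0]
  iterate-step (suc k) =
    Φ-contracting (proj₂ (iterate k)) (proj₂ (iterate (suc k))) (iterate-step k)

  -- With `≤′` the induction runs on the larger index while the precision `m` stays fixed.
  iterate-stable : ∀ {m n} → m ℕ.≤′ n → proj₁ (iterate m) ≈[ m ] proj₁ (iterate n)
  iterate-stable ℕ.≤′-refl = ≈[]-refl
  iterate-stable (ℕ.≤′-step {n} m≤n) = ≈[]-trans (iterate-stable m≤n)
    (≈[]-weaken (ℕ.≤′⇒≤ m≤n) (iterate-step n))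

  -- The diagonal limit: degree `n` no longer changes from iterate `suc n` on.
  solution : A
  q     solution n = q (proj₁ (iterate (suc n))) n
  deg-q solution n = deg-q (proj₁ (iterate (suc n))) n

  solution≈iterate : ∀ k → solution ≈[ k ] proj₁ (iterate k)
  solution≈iterate k = mk≈[] λ n n<k →
    coeff-≈[] (iterate-stable (ℕ.≤⇒≤′ n<k)) n (ℕ.n<1+n n)

  solution∈U : U solution
  solution∈U = mkU (q₀≈1 (proj₂ (iterate 1)))

  solution-fixed : solution ≈ᴬ Φ solution solution∈U
  -- Both sides are compared with iterate `suc N`, which is `Φ` of iterate `N`.
  solution-fixed = ≈[]⇒≈ᴬ λ N → ≈[]-weaken (ℕ.n≤1+n N) (≈[]-trans
    (solution≈iterate (suc N))
    (≈[]-sym (Φ-contracting solution∈U (proj₂ (iterate N)) (solution≈iterate N))))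

  -- Agreement below `N` passes through `Φ` to agreement below `suc N`, so two fixed points agree in
  -- every degree.
  fixed-unique : ∀ {V W} (V∈U : U V) (W∈U : U W) → V ≈ᴬ Φ V V∈U → W ≈ᴬ Φ W W∈U → V ≈ᴬ W
  fixed-unique {V} {W} V∈U W∈U V≈ΦV W≈ΦW = ≈[]⇒≈ᴬ agree
    where
    agree : ∀ N → V ≈[ N ] W
    agree zero    = ≈[0]
    agree (suc N) = ≈[]-trans (≈ᴬ⇒≈[] V≈ΦV)
      (≈[]-trans (Φ-contracting V∈U W∈U (agree N)) (≈[]-sym (≈ᴬ⇒≈[] W≈ΦW)))

theorem4p1 : let open Aℂ in
    ∃! _≈ᴬ_ (λ V → Σ[ V∈U ∈ U V ]
    V ≈ᴬ 1ᴬ + y/x - 1/x * V - ∂x V - 1/x * ∂y V + 1/x * log V V∈U)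
theorem4p1 = solution , (solution∈U , solution-fixed) ,
  λ (W∈U , W≈ΦW) → fixed-unique solution∈U W∈U solution-fixed W≈ΦW
  where open FixedPoint ℂ-commutativeRing ℚ→ℂ
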